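{- For every positive integer $n$, $$21\,t_n\equiv 0\pmod{10n+3},$$ where $t_n=\dfrac{\binom{15n}{5n}\binom{5n-1}{n-1}}{(10n+1)\binom{3n}{n}}$.
   Context: For a positive integer $n$, $t_n=\dfrac{\binom{15n}{5n}\binom{5n-1}{n-1}}{(10n+1)\binom{3n}{n}}$. It is a previously known result (Z.-W. Sun) that $t_n$ is an integer for every positive integer $n$; the congruence is between integers. -}

module Defs where

open import Data.Nat.Base using (ℕ; zero; suc; _+_; _*_; _∸_; _≤_; z≤n; s≤s; NonZero)
open import Data.Nat.Properties using (m*n≢0; m≤n*m)
open import Data.Nat.Combinatorics using (_C_; nCk+nC[k+1]≡[n+1]C[k+1])
open import Data.Integer.Base using (ℤ; +_; _-_)
open import Data.Integer.Divisibility.Signed using (_∣_)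
open import Data.Rational.Base using (ℚ; _/_)
open import Relation.Binary.PropositionalEquality using (subst)

infix 4 _≡_[mod_]

_≡_[mod_] : ℤ → ℤ → ℤ → Set
a ≡ b [mod m ] = m ∣ (a - b)

nCk≢0 : ∀ {n k} → k ≤ n → NonZero (n C k)
nCk≢0 {n}     {zero}  z≤n       = _
nCk≢0 {suc n} {suc k} (s≤s k≤n) =
  subst NonZero (nCk+nC[k+1]≡[n+1]C[k+1] n k) (sum≢0 (nCk≢0 k≤n))
  where
  sum≢0 : ∀ {a b} → NonZero a → NonZero (a + b)
  sum≢0 {suc a} _ = _

tNumerator : ℕ → ℕ
tNumerator n = ((15 * n) C (5 * n)) * ((5 * n ∸ 1) C (n ∸ 1))

tDenominator : ℕ → ℕ
tDenominator n = (10 * n + 1) * ((3 * n) C n)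

tDenominator≢0 : ∀ n → NonZero (tDenominator n)
tDenominator≢0 n = m*n≢0 (10 * n + 1) ((3 * n) C n) {{m+1≢0 (10 * n)}} {{nCk≢0 (m≤n*m n 3)}}
  where
  m+1≢0 : ∀ m → NonZero (m + 1)
  m+1≢0 zero    = _
  m+1≢0 (suc m) = _

-- The quotient is taken in ℚ, so no rounding is involved.  Positivity of n
-- makes both truncated subtractions in the numerator exact.
t : (n : ℕ) → .{{_ : NonZero n}} → ℚ
t n = _/_ (+ tNumerator n) (tDenominator n) {{tDenominator≢0 n}}

{-# OPTIONS --safe #-}
-- Cancelling factorials, t_n = (15n)! (2n)! / (5 (10n+1)! (4n)! (3n)!).  By Legendre's formula a
-- quotient of products of factorials is an integer as soon as, for every q > 1, the floors ⌊a/q⌋ of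
-- the factorials a! below sum to at most those above; the factors 10n+3 and 21 are turned into
-- (10n+3)!/(10n+2)! and 21!/20!.  All floors involved are determined by j = ⌊60n/q⌋, and both sides
-- are periodic in j modulo 60 up to the same linear term, so the inequality is a finite check.
-- If q divides 10n+1, or 10n+3 with q ≥ 9, then j is 6k − 1 or 6k − 2 with k prime to 10, and there
-- the inequality is strict, which pays for the extra factor.  The only other q > 1 dividing 10n+3
-- are 3 and 7, and these divide 21.
-- The factor 5 is not visible in the individual floors: one has to sum over all powers of 5.
module Submission where

open import Defs
open import Data.Fin.Base using (Fin; zero; suc; toℕ; fromℕ<)
open import Data.Fin.Properties using (all?; toℕ-fromℕ<)
import Data.Integer.Properties as ℤ
open import Data.Integer.Divisibility.Signed using (∣ᵤ⇒∣) renaming (_∣_ to _∣ℤ_)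
open import Data.List.Base using (List; []; _∷_; map)
open import Data.List.Properties using (map-∘; map-cong)
open import Data.List.Relation.Unary.All using (All; []; _∷_)
open import Data.Nat.Base
open import Data.Nat.Combinatorics
open import Data.Nat.Coprimality using (Coprime; coprime-divisor)
open import Data.Nat.DivMod
open import Data.Nat.Divisibility
open import Data.Nat.ListAction using (sum; product)
open import Data.Nat.Primality
open import Data.Nat.Primality.Factorisation using (factorise; PrimeFactorisation)
open import Data.Nat.Properties
open import Data.Nat.Tactic.RingSolver using (solve-∀)
open import Data.Product using (∃-syntax; _×_; _,_; proj₁; proj₂)
import Data.Rational.Base as ℚ
open import Data.Rational.Properties using (fromℚᵘ-cong)
open import Data.Rational.Unnormalised.Base using (mkℚᵘ; *≡*)
open import Data.Sum using (inj₁; inj₂)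
open import Relation.Binary.PropositionalEquality
  using (_≡_; refl; sym; trans; cong; cong₂; subst; subst₂; module ≡-Reasoning)
open import Relation.Nullary using (¬_; yes; no; contradiction)
open import Relation.Nullary.Decidable using (from-yes; from-no; _→-dec_; _×-dec_)

private
  variable
    a b m n p q : ℕ
    as bs : List ℕ

-- Legendre's formula

/-unique : .{{_ : NonZero q}} → a * q ≤ m → m < suc a * q → m / q ≡ a
/-unique {q} {a} lo hi =
  ≤-antisym (s≤s⁻¹ (m<n*o⇒m/o<n hi)) (subst (_≤ _) (m*n/n≡m a q) (/-monoˡ-≤ q lo))

m<[1+m/q]*q : ∀ m q .{{_ : NonZero q}} → m < suc (m / q) * q
m<[1+m/q]*q m q = begin-strict
  m                   ≡⟨ m≡m%n+[m/n]*n m q ⟩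
  m % q + m / q * q   <⟨ +-monoˡ-< (m / q * q) (m%n<n m q) ⟩
  suc (m / q) * q     ∎
  where open ≤-Reasoning

/-suc-∣ : .{{_ : NonZero q}} → q ∣ suc m → suc m / q ≡ suc (m / q)
/-suc-∣ {q@(suc q-1)} {m} (divides (suc j) eq) = begin
  suc m / q         ≡⟨ /-congˡ eq ⟩
  suc j * q / q     ≡⟨ m*n/n≡m (suc j) q ⟩
  suc j             ≡⟨ cong suc (/-unique lo (≤-reflexive eq)) ⟨
  suc (m / q)       ∎
  where
  open ≡-Reasoning
  lo : j * q ≤ m
  lo = subst (j * q ≤_) (sym (suc-injective eq)) (m≤n+m (j * q) q-1)

/-suc-∤ : .{{_ : NonZero q}} → q ∤ suc m → suc m / q ≡ m / q
/-suc-∤ {q} {m} q∤ = /-unique (m≤n⇒m≤1+n (m/n*n≤m m q))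
  (≤∧≢⇒< (m<[1+m/q]*q m q) λ eq → q∤ (divides (suc (m / q)) eq))

prime∤1 : Prime p → p ∤ 1
prime∤1 pp p∣1 = ¬prime[1] (subst Prime (∣1⇒≡1 p∣1) pp)

prime∤* : Prime p → p ∤ m → p ∤ n → p ∤ m * n
prime∤* {m = m} {n} pp p∤m p∤n p∣mn with euclidsLemma m n pp p∣mn
... | inj₁ p∣m = p∤m p∣m
... | inj₂ p∣n = p∤n p∣n

-- The multiples of p up to m are p, 2p, ..., ⌊m/p⌋p, whose product is p^⌊m/p⌋ · ⌊m/p⌋!; `c`
-- collects the other factors.
!-split : .{{_ : NonZero p}} → Prime p → ∀ m →
  ∃[ c ] p ∤ c × m ! ≡ p ^ (m / p) * (m / p) ! * c
!-split {p} pp zero rewrite 0/n≡0 p {{prime⇒nonZero pp}} = 1 , prime∤1 pp , refl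
!-split {p} pp (suc m) with !-split pp m | p ∣? suc m
... | c , p∤c , eq | no p∤1+m rewrite /-suc-∤ p∤1+m =
  c * suc m , prime∤* pp p∤c p∤1+m , (begin
    suc m * m !                           ≡⟨ cong (suc m *_) eq ⟩
    suc m * (p ^ (m / p) * (m / p) ! * c) ≡⟨ shuffle (suc m) (p ^ (m / p) * (m / p) !) c ⟩
    p ^ (m / p) * (m / p) ! * (c * suc m) ∎)
  where
  open ≡-Reasoning
  shuffle : ∀ x y z → x * (y * z) ≡ y * (z * x)
  shuffle = solve-∀
... | c , p∤c , eq | yes p∣1+m rewrite /-suc-∣ p∣1+m = c , p∤c , (begin
    suc m * m !                                              ≡⟨ cong₂ _*_ 1+m≡ eq ⟩
    suc (m / p) * p * (p ^ (m / p) * (m / p) ! * c)          ≡⟨ shuffle (suc (m / p)) p (p ^ (m / p)) ((m / p) !) c ⟩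
    p * p ^ (m / p) * (suc (m / p) * (m / p) !) * c          ∎)
  where
  open ≡-Reasoning
  1+m≡ : suc m ≡ suc (m / p) * p
  1+m≡ = trans (sym (m/n*n≡m p∣1+m)) (cong (_* p) (/-suc-∣ p∣1+m))
  shuffle : ∀ x p y z c → x * p * (y * z * c) ≡ p * y * (x * z) * c
  shuffle = solve-∀

-- ⌊m/p⌋ + ⌊m/p²⌋ + … + ⌊m/pᴺ⌋, with the iterated quotient ⌊⌊m/p⌋/p⌋ in place of ⌊m/p²⌋, and so on.
legendreSum : (p : ℕ) .{{_ : NonZero p}} → ℕ → ℕ → ℕ
legendreSum p zero    m = 0
legendreSum p (suc N) m = m / p + legendreSum p N (m / p)

-- `N` both bounds the argument and counts the divisions left in `legendreSum`, so each division has
-- to lower the bound by one.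
m≤1+N⇒m/p≤N : ∀ {N} p .{{_ : NonZero p}} → Prime p → m ≤ suc N → m / p ≤ N
m≤1+N⇒m/p≤N {zero}  p pp _ = subst (_≤ _) (sym (0/n≡0 p)) z≤n
m≤1+N⇒m/p≤N {suc m} p pp m≤1+N = s≤s⁻¹ (<-≤-trans (m/n<m (suc m) p (nonTrivial⇒n>1 p {{prime⇒nonTrivial pp}})) m≤1+N)

!-legendre : .{{_ : NonZero p}} → Prime p → ∀ N {m} → m ≤ N →
  ∃[ c ] p ∤ c × m ! ≡ p ^ legendreSum p N m * c
!-legendre pp zero z≤n = 1 , prime∤1 pp , refl
!-legendre {p} pp (suc N) {m} m≤1+N
  with c , p∤c , eq ← !-split pp m
     | d , p∤d , eq′ ← !-legendre pp N (m≤1+N⇒m/p≤N p pp m≤1+N)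
  = d * c , prime∤* pp p∤d p∤c , (begin
    m !                                               ≡⟨ eq ⟩
    p ^ (m / p) * (m / p) ! * c                       ≡⟨ cong (λ x → p ^ (m / p) * x * c) eq′ ⟩
    p ^ (m / p) * (p ^ S * d) * c                     ≡⟨ shuffle (p ^ (m / p)) (p ^ S) d c ⟩
    p ^ (m / p) * p ^ S * (d * c)                     ≡⟨ cong (_* (d * c)) (^-distribˡ-+-* p (m / p) S) ⟨
    p ^ (m / p + S) * (d * c)                         ∎)
  where
  open ≡-Reasoning
  S = legendreSum p N (m / p)
  shuffle : ∀ x y d c → x * (y * d) * c ≡ x * y * (d * c)
  shuffle = solve-∀

∏! : List ℕ → ℕ
∏! as = product (map _! as)

∏!-legendre : .{{_ : NonZero p}} → Prime p → ∀ N → All (_≤ N) as →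
  ∃[ c ] p ∤ c × ∏! as ≡ p ^ sum (map (legendreSum p N) as) * c
∏!-legendre pp N [] = 1 , prime∤1 pp , refl
∏!-legendre {p} {a ∷ as} pp N (a≤N ∷ as≤N)
  with c , p∤c , eq ← !-legendre pp N a≤N
     | d , p∤d , eq′ ← ∏!-legendre pp N as≤N
  = c * d , prime∤* pp p∤c p∤d , (begin
    a ! * ∏! as                                ≡⟨ cong₂ _*_ eq eq′ ⟩
    p ^ S * c * (p ^ T * d)                           ≡⟨ shuffle (p ^ S) c (p ^ T) d ⟩
    p ^ S * p ^ T * (c * d)                           ≡⟨ cong (_* (c * d)) (^-distribˡ-+-* p S T) ⟨
    p ^ (S + T) * (c * d)                             ∎)
  where
  open ≡-Reasoning
  S = legendreSum p N a
  T = sum (map (legendreSum p N) as)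
  shuffle : ∀ x c y d → x * c * (y * d) ≡ x * y * (c * d)
  shuffle = solve-∀

-- Divisibility tested at prime powers

p^k∣p^n*c⇒k≤n : .{{_ : NonZero p}} → p ∤ m → ∀ k n → p ^ k ∣ p ^ n * m → k ≤ n
p^k∣p^n*c⇒k≤n p∤m zero    n       _ = z≤n
p^k∣p^n*c⇒k≤n {p} {m} p∤m (suc k) zero d =
  contradiction (subst (p ∣_) (*-identityˡ m) (∣-trans (m∣m*n (p ^ k)) d)) p∤m
p^k∣p^n*c⇒k≤n {p} {m} p∤m (suc k) (suc n) d =
  s≤s (p^k∣p^n*c⇒k≤n p∤m k n (*-cancelˡ-∣ p (subst (p * p ^ k ∣_) (*-assoc p (p ^ n) m) d)))

p^k∣m*n⇒p^k∣n : .{{_ : NonZero p}} → Prime p → p ∤ m → ∀ k {n} → p ^ k ∣ m * n → p ^ k ∣ n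
p^k∣m*n⇒p^k∣n pp p∤m zero    d = 1∣ _
p^k∣m*n⇒p^k∣n {p} {m} pp p∤m (suc k) {n} d
  with euclidsLemma m n pp (∣-trans (m∣m*n (p ^ k)) d)
... | inj₁ p∣m = contradiction p∣m p∤m
... | inj₂ (divides-refl j) = subst (p * p ^ k ∣_) (*-comm p j)
  (*-monoʳ-∣ p (p^k∣m*n⇒p^k∣n pp p∤m k (*-cancelˡ-∣ p (subst (p * p ^ k ∣_) (shuffle m j p) d))))
  where
  shuffle : ∀ m j p → m * (j * p) ≡ p * (m * j)
  shuffle = solve-∀

-- Induction on the prime factors: a factor q is split off both sides. At p = q this shifts the
-- exponent by one; at p ≠ q the factor q is prime to p and cancels.
product∣-local : ∀ {ps} → All Prime ps →
  (∀ {p} → Prime p → ∀ k → p ^ k ∣ product ps → p ^ k ∣ b) → product ps ∣ b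
product∣-local [] _ = 1∣ _
product∣-local {b₀} {q ∷ ps} (pq ∷ pps) loc
  with divides-refl b ← subst (_∣ b₀) (*-identityʳ q) (loc pq 1 (*-monoʳ-∣ q (1∣ product ps)))
  = subst (q * product ps ∣_) (*-comm q b) (*-monoʳ-∣ q (product∣-local pps loc′))
  where
  instance _ = prime⇒nonZero pq
  loc′ : ∀ {p} → Prime p → ∀ k → p ^ k ∣ product ps → p ^ k ∣ b
  loc′ {p} pp k d with p ≟ q
  ... | yes refl = *-cancelˡ-∣ q (subst (q * q ^ k ∣_) (*-comm b q) (loc pq (suc k) (*-monoʳ-∣ q d)))
  ... | no p≢q   = p^k∣m*n⇒p^k∣n {{prime⇒nonZero pp}} pp p∤q k
                     (subst (p ^ k ∣_) (*-comm b q) (loc pp k (∣n⇒∣m*n q d)))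
    where
    p∤q : p ∤ q
    p∤q p∣q with prime⇒irreducible pq p∣q
    ... | inj₁ refl = ¬prime[1] pp
    ... | inj₂ p≡q  = p≢q p≡q

∣-local : .{{_ : NonZero a}} → (∀ {p} → Prime p → ∀ k → p ^ k ∣ a → p ^ k ∣ b) → a ∣ b
∣-local {a} {b} loc =
  subst (_∣ b) (sym isFactorisation) (product∣-local factorsPrime
    λ {p} pp k d → loc pp k (subst (p ^ k ∣_) (sym isFactorisation) d))
  where open PrimeFactorisation (factorise a)

∏!≢0 : ∀ as → NonZero (∏! as)
∏!≢0 []       = _
∏!≢0 (a ∷ as) = m*n≢0 (a !) (∏! as) {{a !≢0}} {{∏!≢0 as}}

-- If p^k divides the left side, then k is at most its Legendre exponent, as the cofactor is prime
-- to p, and hence at most the exponent on the right.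
∏!-∣ : ∀ N → All (_≤ N) as → All (_≤ N) bs →
  (∀ p .{{_ : NonZero p}} → Prime p →
    sum (map (legendreSum p N) as) ≤ sum (map (legendreSum p N) bs)) →
  ∏! as ∣ ∏! bs
∏!-∣ {as} {bs} N as≤N bs≤N S≤T = ∣-local {{∏!≢0 as}} λ {p} pp → loc p {{prime⇒nonZero pp}} pp
  where
  loc : ∀ p .{{_ : NonZero p}} → Prime p → ∀ k → p ^ k ∣ ∏! as → p ^ k ∣ ∏! bs
  loc p pp k d
    with c , p∤c , eq  ← ∏!-legendre pp N as≤N
       | e , _   , eq′ ← ∏!-legendre pp N bs≤N
    = subst (p ^ k ∣_) (sym eq′) (∣m⇒∣m*n e (p^-mono-∣ (≤-trans
        (p^k∣p^n*c⇒k≤n p∤c k _ (subst (p ^ k ∣_) eq d)) (S≤T p pp))))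
    where
    p^-mono-∣ : ∀ {i j} → i ≤ j → p ^ i ∣ p ^ j
    p^-mono-∣ {i} i≤j with l , refl ← m≤n⇒∃[o]m+o≡n i≤j =
      subst (p ^ i ∣_) (sym (^-distribˡ-+-* p i l)) (m∣m*n (p ^ l))

-- From floor inequalities to Legendre sums

sum-map-+ : ∀ (f g : ℕ → ℕ) as → sum (map (λ a → f a + g a) as) ≡ sum (map f as) + sum (map g as)
sum-map-+ f g []       = refl
sum-map-+ f g (a ∷ as) = trans (cong (f a + g a +_) (sum-map-+ f g as)) (shuffle (f a) (g a) _ _)
  where
  shuffle : ∀ w x y z → w + x + (y + z) ≡ w + y + (x + z)
  shuffle = solve-∀

sum-legendreSum-mono : ∀ N .{{_ : NonZero p}} → 1 < p → ∀ as bs →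
  (∀ q .{{_ : NonZero q}} → 1 < q → sum (map (_/ q) as) ≤ sum (map (_/ q) bs)) →
  sum (map (legendreSum p N) as) ≤ sum (map (legendreSum p N) bs)
sum-legendreSum-mono zero 1<p as bs le = ≤-trans (≤-reflexive (sum-map-0 as)) z≤n
  where
  sum-map-0 : ∀ as → sum (map (λ _ → 0) as) ≡ 0
  sum-map-0 []       = refl
  sum-map-0 (_ ∷ as) = sum-map-0 as
sum-legendreSum-mono {p} (suc N) 1<p as bs le =
  subst₂ _≤_ (sym (unfold as)) (sym (unfold bs))
    (+-mono-≤ (le p 1<p) (sum-legendreSum-mono N 1<p (map (_/ p) as) (map (_/ p) bs) le′))
  where
  unfold : ∀ as → sum (map (legendreSum p (suc N)) as) ≡
                  sum (map (_/ p) as) + sum (map (legendreSum p N) (map (_/ p) as))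
  unfold as = trans (sum-map-+ (_/ p) (λ a → legendreSum p N (a / p)) as)
                    (cong (λ xs → sum (map (_/ p) as) + sum xs) (map-∘ as))
  le′ : ∀ q .{{_ : NonZero q}} → 1 < q →
        sum (map (_/ q) (map (_/ p) as)) ≤ sum (map (_/ q) (map (_/ p) bs))
  -- Dividing the lists by p turns the floor at q into the floor at pq, so the hypothesis passes to
  -- the quotients because it covers every q > 1.
  le′ q 1<q = subst₂ _≤_ (sym (nested as)) (sym (nested bs)) (le (p * q) (<-≤-trans 1<q (m≤n*m q p)))
    where
    instance _ = m*n≢0 p q
    nested : ∀ as → sum (map (_/ q) (map (_/ p) as)) ≡ sum (map (_/ (p * q)) as)
    nested as = cong sum (trans (sym (map-∘ as)) (map-cong (λ a → m/n/o≡m/[n*o] a p q) as))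

legendreSum-0 : ∀ p .{{_ : NonZero p}} N → legendreSum p N 0 ≡ 0
legendreSum-0 p zero    = refl
legendreSum-0 p (suc N) = trans (cong (λ x → x + legendreSum p N x) (0/n≡0 p)) (legendreSum-0 p N)

-- After `N` divisions the quotient is already 0, so one more term adds nothing.
legendreSum-stable : .{{_ : NonZero p}} → Prime p → ∀ N {m} → m ≤ N →
  legendreSum p (suc N) m ≡ legendreSum p N m
legendreSum-stable {p} pp zero    z≤n   = trans (+-identityʳ (0 / p)) (0/n≡0 p)
legendreSum-stable {p} pp (suc N) {m} m≤1+N =
  cong (m / p +_) (legendreSum-stable pp N (m≤1+N⇒m/p≤N p pp m≤1+N))

-- For a prime p = d + 1 this is (p - 1)v_p(m!) < m, familiar from the digit-sum form of Legendre's
-- formula. With a = ⌊m/p⌋, induction gives less than da + a = ap ≤ m.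
legendreSum-< : ∀ d N m .{{_ : NonZero m}} → d * legendreSum (suc d) N m < m
legendreSum-< d zero    m = subst (_< m) (sym (*-zeroʳ d)) (>-nonZero⁻¹ m)
legendreSum-< d (suc N) m with m / suc d in eq
... | zero  rewrite legendreSum-0 (suc d) N | *-zeroʳ d = >-nonZero⁻¹ m
... | suc a = begin-strict
  d * (suc a + legendreSum (suc d) N (suc a))       ≡⟨ *-distribˡ-+ d (suc a) _ ⟩
  d * suc a + d * legendreSum (suc d) N (suc a)     <⟨ +-monoʳ-< (d * suc a) (legendreSum-< d N (suc a)) ⟩
  d * suc a + suc a                                 ≡⟨ shuffle d (suc a) ⟩
  suc a * suc d                                     ≡⟨ cong (_* suc d) eq ⟨
  m / suc d * suc d                                 ≤⟨ m/n*n≤m m (suc d) ⟩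
  m                                                 ∎
  where
  open ≤-Reasoning
  shuffle : ∀ d x → d * x + x ≡ x * (1 + d)
  shuffle = solve-∀

-- Floor inequalities

-- For j = ⌊60n/q⌋ these are ⌊10n/q⌋ + ⌊4n/q⌋ + ⌊3n/q⌋ and ⌊15n/q⌋ + ⌊2n/q⌋.
lower upper : ℕ → ℕ
lower j = j / 6 + (j / 15 + (j / 20 + 0))
upper j = j / 4 + (j / 30 + 0)

/-shift : ∀ r a d e .{{_ : NonZero d}} → (r + a * (e * d)) / d ≡ r / d + a * e
/-shift r a d e = begin
  (r + a * (e * d)) / d     ≡⟨ cong (λ x → (r + x) / d) (*-assoc a e d) ⟨
  (r + a * e * d) / d       ≡⟨ +-distrib-/-∣ʳ r (n∣m*n (a * e)) ⟩
  r / d + a * e * d / d     ≡⟨ cong (r / d +_) (m*n/n≡m (a * e) d) ⟩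
  r / d + a * e             ∎
  where open ≡-Reasoning

-- The growth per period is 17 = 10 + 4 + 3, and 17 = 15 + 2 for `upper`; equal growth is what
-- reduces their comparison to residues modulo 60.
lower-shift : ∀ r a → lower (r + a * 60) ≡ lower r + a * 17
lower-shift r a = trans
  (cong₂ _+_ (/-shift r a 6 10) (cong₂ _+_ (/-shift r a 15 4) (cong (_+ 0) (/-shift r a 20 3))))
  (shuffle (r / 6) (r / 15) (r / 20) a)
  where
  shuffle : ∀ x y z a → x + a * 10 + (y + a * 4 + (z + a * 3 + 0)) ≡ x + (y + (z + 0)) + a * 17
  shuffle = solve-∀

upper-shift : ∀ r a → upper (r + a * 60) ≡ upper r + a * 17
upper-shift r a = trans
  (cong₂ _+_ (/-shift r a 4 15) (cong (_+ 0) (/-shift r a 30 2)))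
  (shuffle (r / 4) (r / 30) a)
  where
  shuffle : ∀ x y a → x + a * 15 + (y + a * 2 + 0) ≡ x + (y + 0) + a * 17
  shuffle = solve-∀

lower≤upper-residue : (r : Fin 60) → lower (toℕ r) ≤ upper (toℕ r)
lower≤upper-residue = from-yes (all? {60} λ r → lower (toℕ r) ≤? upper (toℕ r))

lower≤upper : ∀ j → lower j ≤ upper j
lower≤upper j = subst (λ j → lower j ≤ upper j) (sym (m≡m%n+[m/n]*n j 60)) (subst₂ _≤_
  (sym (lower-shift (j % 60) (j / 60))) (sym (upper-shift (j % 60) (j / 60)))
  (+-monoˡ-≤ (j / 60 * 17)
    (subst (λ r → lower r ≤ upper r) (toℕ-fromℕ< (m%n<n j 60))
      (lower≤upper-residue (fromℕ< (m%n<n j 60))))))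

-- The congruence forces b to be one of the units 1, 3, 7, 9 modulo 10.
lower<upper-residue : (b d : Fin 10) (c i : Fin 2) →
  toℕ b * toℕ d % 10 ≡ 1 + 2 * toℕ c →
  suc (toℕ i) ≤ 6 * toℕ b × lower (6 * toℕ b ∸ suc (toℕ i)) < upper (6 * toℕ b ∸ suc (toℕ i))
lower<upper-residue = from-yes (all? {10} λ b → all? {10} λ d → all? {2} λ c → all? {2} λ i →
  (toℕ b * toℕ d % 10 ≟ 1 + 2 * toℕ c) →-dec
  ((suc (toℕ i) ≤? 6 * toℕ b) ×-dec
   (lower (6 * toℕ b ∸ suc (toℕ i)) <? upper (6 * toℕ b ∸ suc (toℕ i)))))

-- Since kq is 1 or 3 modulo 10, the residue of k is covered by the finite check; the remaining
-- multiple of 10 in k moves j by whole periods of 60.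
lower<upper : ∀ j k q n (c i : Fin 2) → k * q ≡ 10 * n + (1 + 2 * toℕ c) →
  j + suc (toℕ i) ≡ 6 * k → lower j < upper j
lower<upper j k q n c i kq≡ j+i≡ =
  subst (λ j → lower j < upper j) (sym j≡)
    (subst₂ _≤_ (cong suc (sym (lower-shift r tens))) (sym (upper-shift r tens))
      (+-monoˡ-≤ (tens * 17) (proj₂ residue)))
  where
  open ≡-Reasoning
  tens = k / 10
  kᵤ = fromℕ< (m%n<n k 10)
  qᵤ = fromℕ< (m%n<n q 10)
  c<10 : (c : Fin 2) → (1 + 2 * toℕ c) % 10 ≡ 1 + 2 * toℕ c
  c<10 zero       = refl
  c<10 (suc zero) = refl
  kᵤqᵤ≡ : toℕ kᵤ * toℕ qᵤ % 10 ≡ 1 + 2 * toℕ c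
  kᵤqᵤ≡ = begin
    toℕ kᵤ * toℕ qᵤ % 10            ≡⟨ cong₂ (λ x y → x * y % 10)
                                         (toℕ-fromℕ< (m%n<n k 10)) (toℕ-fromℕ< (m%n<n q 10)) ⟩
    (k % 10) * (q % 10) % 10        ≡⟨ %-distribˡ-* k q 10 ⟨
    k * q % 10                      ≡⟨ cong (_% 10) kq≡ ⟩
    (10 * n + (1 + 2 * toℕ c)) % 10 ≡⟨ %-remove-+ˡ (1 + 2 * toℕ c) (m∣m*n n) ⟩
    (1 + 2 * toℕ c) % 10            ≡⟨ c<10 c ⟩
    1 + 2 * toℕ c                   ∎
  residue = lower<upper-residue kᵤ qᵤ c i kᵤqᵤ≡
  r = 6 * toℕ kᵤ ∸ suc (toℕ i)
  shuffle : ∀ x y → 6 * (x + y * 10) ≡ 6 * x + y * 60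
  shuffle = solve-∀
  swap : ∀ x y z → x + y + z ≡ x + z + y
  swap = solve-∀
  j≡ : j ≡ r + tens * 60
  j≡ = +-cancelʳ-≡ (suc (toℕ i)) j (r + tens * 60) (begin
    j + suc (toℕ i)                 ≡⟨ j+i≡ ⟩
    6 * k                           ≡⟨ cong (6 *_) (m≡m%n+[m/n]*n k 10) ⟩
    6 * (k % 10 + tens * 10)        ≡⟨ shuffle (k % 10) tens ⟩
    6 * (k % 10) + tens * 60        ≡⟨ cong (λ x → 6 * x + tens * 60) (toℕ-fromℕ< (m%n<n k 10)) ⟨
    6 * toℕ kᵤ + tens * 60          ≡⟨ cong (_+ tens * 60) (m∸n+n≡m (proj₁ residue)) ⟨
    r + suc (toℕ i) + tens * 60     ≡⟨ swap r (suc (toℕ i)) (tens * 60) ⟩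
    r + tens * 60 + suc (toℕ i)     ∎)

-- Nested floors merge into division by qd, and d cancels. With e · d = 60, the single number
-- ⌊60n/q⌋ thus determines ⌊en/q⌋.
/-refine : ∀ n q d e .{{_ : NonZero q}} .{{_ : NonZero d}} → e * d * n / q / d ≡ e * n / q
/-refine n q d e = begin
  e * d * n / q / d         ≡⟨ m/n/o≡m/[n*o] (e * d * n) q d ⟩
  e * d * n / (q * d)       ≡⟨ /-congˡ {o = q * d} (shuffle e d n) ⟩
  e * n * d / (q * d)       ≡⟨ m*n/o*n≡m/o (e * n) d q ⟩
  e * n / q                 ∎
  where
  open ≡-Reasoning
  instance _ = m*n≢0 q d
  shuffle : ∀ e d n → e * d * n ≡ e * n * d
  shuffle = solve-∀

lower-refine : ∀ n q .{{_ : NonZero q}} →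
  lower (60 * n / q) ≡ sum (map (_/ q) (10 * n ∷ 4 * n ∷ 3 * n ∷ []))
lower-refine n q = cong₂ _+_ (/-refine n q 6 10)
  (cong₂ _+_ (/-refine n q 15 4) (cong (_+ 0) (/-refine n q 20 3)))

upper-refine : ∀ n q .{{_ : NonZero q}} →
  upper (60 * n / q) ≡ sum (map (_/ q) (15 * n ∷ 2 * n ∷ []))
upper-refine n q = cong₂ _+_ (/-refine n q 4 15) (cong (_+ 0) (/-refine n q 30 2))

floors-≤ : ∀ n q .{{_ : NonZero q}} →
  sum (map (_/ q) (10 * n ∷ 4 * n ∷ 3 * n ∷ [])) ≤ sum (map (_/ q) (15 * n ∷ 2 * n ∷ []))
floors-≤ n q = subst₂ _≤_ (lower-refine n q) (upper-refine n q) (lower≤upper (60 * n / q))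

-- Since 60n = 6kq − 6c with 0 < 6c ≤ 2q, the quotient ⌊60n/q⌋ is 6k − 1 or 6k − 2.
floors-< : ∀ n q k (c : Fin 2) .{{_ : NonZero q}} →
  k * q ≡ 10 * n + (1 + 2 * toℕ c) → 3 * (1 + 2 * toℕ c) ≤ q →
  sum (map (_/ q) (10 * n ∷ 4 * n ∷ 3 * n ∷ [])) < sum (map (_/ q) (15 * n ∷ 2 * n ∷ []))
floors-< n q zero c kq≡ 3c≤q = contradiction (trans kq≡ (+-comm (10 * n) _)) λ ()
floors-< n q k@(suc k-1) c kq≡ 3c≤q =
  subst₂ _<_ (lower-refine n q) (upper-refine n q) lower<upper-j
  where
  -- This is 6k - 2, so `suc s` is 6k - 1.
  s = 4 + 6 * k-1
  c′ = 1 + 2 * toℕ c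
  6k≡ : 2 + s ≡ 6 * k
  6k≡ = shuffle k-1
    where
    shuffle : ∀ x → 6 + 6 * x ≡ 6 * (1 + x)
    shuffle = solve-∀
  total : 60 * n + 6 * c′ ≡ (2 + s) * q
  total = begin
    60 * n + 6 * c′     ≡⟨ shuffle n c′ ⟩
    6 * (10 * n + c′)   ≡⟨ cong (6 *_) kq≡ ⟨
    6 * (k * q)         ≡⟨ *-assoc 6 k q ⟨
    6 * k * q           ≡⟨ cong (_* q) 6k≡ ⟨
    (2 + s) * q         ∎
    where
    open ≡-Reasoning
    shuffle : ∀ n c → 60 * n + 6 * c ≡ 6 * (10 * n + c)
    shuffle = solve-∀
  open ≤-Reasoning
  lower<upper-j : lower (60 * n / q) < upper (60 * n / q)
  lower<upper-j with 6 * c′ ≤? q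
  -- Here (6k - 1)q ≤ 60n < 6kq.
  ... | yes 6c≤q = lower<upper (60 * n / q) k q n c zero kq≡
      (trans (cong (_+ 1) (/-unique {a = suc s} lo hi)) (trans (+-comm (suc s) 1) 6k≡))
    where
    lo : suc s * q ≤ 60 * n
    lo = +-cancelʳ-≤ (6 * c′) (suc s * q) (60 * n) (begin
      suc s * q + 6 * c′    ≤⟨ +-monoʳ-≤ (suc s * q) 6c≤q ⟩
      suc s * q + q         ≡⟨ +-comm (suc s * q) q ⟩
      (2 + s) * q           ≡⟨ total ⟨
      60 * n + 6 * c′       ∎)
    hi : 60 * n < (2 + s) * q
    hi = subst (60 * n <_) total (m<m+n (60 * n) z<s)
  -- Here (6k - 2)q ≤ 60n < (6k - 1)q.
  ... | no 6c≰q = lower<upper (60 * n / q) k q n c (suc zero) kq≡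
      (trans (cong (_+ 2) (/-unique {a = s} lo hi)) (trans (+-comm s 2) 6k≡))
    where
    lo : s * q ≤ 60 * n
    lo = +-cancelʳ-≤ (6 * c′) (s * q) (60 * n) (begin
      s * q + 6 * c′        ≡⟨ cong (s * q +_) (*-assoc 2 3 c′) ⟩
      s * q + 2 * (3 * c′)  ≤⟨ +-monoʳ-≤ (s * q) (*-monoʳ-≤ 2 3c≤q) ⟩
      s * q + 2 * q         ≡⟨ shuffle s q ⟩
      (2 + s) * q           ≡⟨ total ⟨
      60 * n + 6 * c′       ∎)
      where
      shuffle : ∀ s q → s * q + 2 * q ≡ (2 + s) * q
      shuffle = solve-∀
    hi : 60 * n < suc s * q
    hi = +-cancelʳ-< (6 * c′) (60 * n) (suc s * q) (begin-strict
      60 * n + 6 * c′       ≡⟨ total ⟩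
      (2 + s) * q           ≡⟨ +-comm q (suc s * q) ⟩
      suc s * q + q         <⟨ +-monoʳ-< (suc s * q) (≰⇒> 6c≰q) ⟩
      suc s * q + 6 * c′    ∎)

-- Small divisors of 10n + 1 and 10n + 3

common-factor : ∀ {d} n c → d ∣ 10 → d ∣ q → q ∣ c + 10 * n → d ∣ c
common-factor {d = d} n c d∣10 d∣q q∣ =
  ∣m+n∣m⇒∣n (subst (d ∣_) (+-comm c (10 * n)) (∣-trans d∣q q∣)) (∣m⇒∣m*n n d∣10)

∣10n+1⇒3≤ : ∀ n q → 1 < q → q ∣ 1 + 10 * n → 3 ≤ q
∣10n+1⇒3≤ n 1 (s≤s ()) _
∣10n+1⇒3≤ n 2 _ q∣ = contradiction (common-factor n 1 (divides 5 refl) (∣-refl {2}) q∣) (from-no (2 ∣? 1))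
∣10n+1⇒3≤ n (suc (suc (suc q))) _ _ = s≤s (s≤s (s≤s z≤n))

-- Divisors of 10n + 3 are prime to 10, which leaves only 3 and 7 below 9, and both divide 21. The
-- bound 9 = 3 · 3 is the one `floors-<` asks for.
∣10n+3⇒9≤ : ∀ n q → 1 < q → q ∣ 3 + 10 * n → q ∤ 21 → 9 ≤ q
∣10n+3⇒9≤ n q 1<q q∣ q∤21 = ≮⇒≥ λ q<9 → excluded q q<9 1<q q∣ q∤21
  where
  even : ∀ {q} → 2 ∣ q → q ∤ 3 + 10 * n
  even 2∣q q∣ = from-no (2 ∣? 3) (common-factor n 3 (divides 5 refl) 2∣q q∣)
  excluded : ∀ q → q < 9 → 1 < q → q ∣ 3 + 10 * n → ¬ (q ∤ 21)
  excluded 1 _ (s≤s ()) _ _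
  excluded 2 _ _ q∣ _ = even (divides 1 refl) q∣
  excluded 3 _ _ _ q∤21 = q∤21 (divides 7 refl)
  excluded 4 _ _ q∣ _ = even (divides 2 refl) q∣
  excluded 5 _ _ q∣ _ = from-no (5 ∣? 3) (common-factor n 3 (divides 2 refl) (∣-refl {5}) q∣)
  excluded 6 _ _ q∣ _ = even (divides 3 refl) q∣
  excluded 7 _ _ _ q∤21 = q∤21 (divides 3 refl)
  excluded 8 _ _ q∣ _ = even (divides 4 refl) q∣
  excluded (suc (suc (suc (suc (suc (suc (suc (suc (suc q))))))))) q<9 _ _ _ =
    contradiction q<9 (≤⇒≯ (m≤m+n 9 q))

-- Floor inequalities for the factorials in t_n

numerator : ℕ → List ℕ
numerator n = 15 * n ∷ 2 * n ∷ []

-- t_n is `∏! (numerator n)` over 5 times `∏! (denominator n)`; the 5 is left from (5n)!/(5n - 1)! =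
-- 5n against n!/(n - 1)! = n.
denominator : ℕ → List ℕ
denominator n = 1 + 10 * n ∷ 4 * n ∷ 3 * n ∷ []

floors-denominator : ∀ n q .{{_ : NonZero q}} → 1 < q →
  sum (map (_/ q) (denominator n)) ≤ sum (map (_/ q) (numerator n))
floors-denominator n q 1<q with q ∣? 1 + 10 * n
... | no  q∤ rewrite /-suc-∤ q∤ = floors-≤ n q
-- The floor of (10n + 1)/q exceeds that of 10n/q by one, which the strict inequality absorbs.
... | yes q∣@(divides k eq) rewrite /-suc-∣ q∣ =
  floors-< n q k zero (trans (sym eq) (+-comm 1 (10 * n))) (∣10n+1⇒3≤ n q 1<q q∣)

floors-denominator-10n+3 : ∀ n q .{{_ : NonZero q}} → 1 < q →
  sum (map (_/ q) (3 + 10 * n ∷ 20 ∷ denominator n)) ≤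
  sum (map (_/ q) (2 + 10 * n ∷ 21 ∷ numerator n))
floors-denominator-10n+3 n q 1<q with q ∣? 3 + 10 * n
... | no  q∤ rewrite /-suc-∤ q∤ =
  +-monoʳ-≤ ((2 + 10 * n) / q) (+-mono-≤ (/-monoˡ-≤ q (n≤1+n 20)) (floors-denominator n q 1<q))
... | yes q∣@(divides k eq) rewrite /-suc-∣ q∣ with q ∣? 21
-- The extra one from 10n + 3 is matched by ⌊21/q⌋ = ⌊20/q⌋ + 1.
...   | yes q∣21 rewrite /-suc-∣ q∣21 = begin
  suc G + (H + L)     ≡⟨ +-suc G (H + L) ⟨
  G + (suc H + L)     ≤⟨ +-monoʳ-≤ G (+-monoʳ-≤ (suc H) (floors-denominator n q 1<q)) ⟩
  G + (suc H + R)     ∎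
  where
  open ≤-Reasoning
  G = (2 + 10 * n) / q
  H = 20 / q
  L = sum (map (_/ q) (denominator n))
  R = sum (map (_/ q) (numerator n))
-- Now q ≥ 9 cannot also divide 10n + 1, as the difference is 2, so the strictness is still free to
-- absorb the extra one.
...   | no  q∤21 = begin
  suc G + (H + sum (map (_/ q) (denominator n)))
                      ≡⟨ cong (λ x → suc G + (H + (x + sum (map (_/ q) (4 * n ∷ 3 * n ∷ []))))) (/-suc-∤ q∤10n+1) ⟩
  suc G + (H + L)     ≡⟨ shuffle G H L ⟩
  G + (H + suc L)     ≤⟨ +-monoʳ-≤ G (+-mono-≤ (/-monoˡ-≤ q (n≤1+n 20)) L<R) ⟩
  G + (21 / q + R)    ∎
  where
  open ≤-Reasoning
  G = (2 + 10 * n) / q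
  H = 20 / q
  L = sum (map (_/ q) (10 * n ∷ 4 * n ∷ 3 * n ∷ []))
  R = sum (map (_/ q) (numerator n))
  9≤q : 9 ≤ q
  9≤q = ∣10n+3⇒9≤ n q 1<q q∣ q∤21
  q∤10n+1 : q ∤ 1 + 10 * n
  q∤10n+1 q∣′ = <⇒≱ (≤-trans (m≤m+n 3 6) 9≤q)
    (∣⇒≤ (∣m+n∣m⇒∣n (subst (q ∣_) (+-comm 2 (1 + 10 * n)) q∣) q∣′))
  L<R : L < R
  L<R = floors-< n q k (suc zero) (trans (sym eq) (+-comm 3 (10 * n))) 9≤q
  shuffle : ∀ x y z → 1 + x + (y + z) ≡ x + (y + (1 + z))
  shuffle = solve-∀

-- A common bound, and the exponent of 5

prime[5] : Prime 5
prime[5] = from-yes (prime? 5)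

linear-≤ : ∀ c d n → c ≤ 22 → d ≤ 15 → c + d * n ≤ 22 + 15 * n
linear-≤ c d n c≤ d≤ = +-mono-≤ c≤ (*-monoˡ-≤ n d≤)

denominator-≤ : ∀ n → All (_≤ 22 + 15 * n) (denominator n)
denominator-≤ n =
  linear-≤ 1 10 n (m≤m+n 1 21) (m≤m+n 10 5) ∷
  linear-≤ 0 4 n z≤n (m≤m+n 4 11) ∷
  linear-≤ 0 3 n z≤n (m≤m+n 3 12) ∷ []

numerator-≤ : ∀ n → All (_≤ 22 + 15 * n) (numerator n)
numerator-≤ n = linear-≤ 0 15 n z≤n ≤-refl ∷ linear-≤ 0 2 n z≤n (m≤m+n 2 13) ∷ []

-- At p = 5 the terms of 15n and 10n telescope against those of 3n and 2n,
-- which leaves n − v₅((4n)!) > 0.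
legendreSum-5 : ∀ n .{{_ : NonZero n}} →
  sum (map (legendreSum 5 (22 + 15 * n)) (5 ∷ denominator n)) ≤
  sum (map (legendreSum 5 (22 + 15 * n)) (4 ∷ numerator n))
legendreSum-5 n = begin
  S 5 + (S (1 + 10 * n) + (S (4 * n) + (S (3 * n) + 0)))
    ≡⟨ cong₂ _+_ S5 (cong₂ _+_ S10 (cong (λ x → S (4 * n) + (x + 0)) (stable 3 (m≤m+n 3 12)))) ⟩
  1 + (2 * n + S′ (2 * n) + (S (4 * n) + (S′ (3 * n) + 0)))
    ≡⟨ shuffle n (S′ (2 * n)) (S (4 * n)) (S′ (3 * n)) ⟩
  2 * n + suc (S (4 * n)) + (S′ (3 * n) + (S′ (2 * n) + 0))
    ≤⟨ +-monoˡ-≤ (S′ (3 * n) + (S′ (2 * n) + 0)) (+-monoʳ-≤ (2 * n) S4n<n) ⟩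
  2 * n + n + (S′ (3 * n) + (S′ (2 * n) + 0))
    ≡⟨ shuffle′ n (S′ (2 * n)) (S′ (3 * n)) ⟩
  3 * n + S′ (3 * n) + (S′ (2 * n) + 0)
    ≡⟨ cong₂ (λ x y → x + (y + 0)) S15 (stable 2 (m≤m+n 2 13)) ⟨
  S (15 * n) + (S (2 * n) + 0)
    ≡⟨ cong (_+ (S (15 * n) + (S (2 * n) + 0))) (legendreSum-0 5 (21 + 15 * n)) ⟨
  S 4 + (S (15 * n) + (S (2 * n) + 0)) ∎
  where
  open ≤-Reasoning
  S S′ : ℕ → ℕ
  S  = legendreSum 5 (22 + 15 * n)
  S′ = legendreSum 5 (21 + 15 * n)
  S5 : S 5 ≡ 1
  S5 = cong suc (legendreSum-0 5 (20 + 15 * n))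
  unfold : ∀ x y → x / 5 ≡ y → S x ≡ y + S′ y
  unfold x y = cong (λ y → y + S′ y)
  S10 : S (1 + 10 * n) ≡ 2 * n + S′ (2 * n)
  S10 = unfold (1 + 10 * n) (2 * n) (trans (/-congˡ {o = 5} (cong suc (*-comm 10 n)))
    (trans (/-shift 1 n 5 2) (*-comm n 2)))
  S15 : S (15 * n) ≡ 3 * n + S′ (3 * n)
  S15 = unfold (15 * n) (3 * n) (trans (/-congˡ {o = 5} (eq n)) (m*n/n≡m (3 * n) 5))
    where
    eq : ∀ n → 15 * n ≡ 3 * n * 5
    eq = solve-∀
  -- Unfolding one term of 15n and 10n + 1 leaves tails with one division fewer; stability lets the
  -- sums at 3n and 2n match them.
  stable : ∀ d → d ≤ 15 → S (d * n) ≡ S′ (d * n)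
  stable d d≤15 = legendreSum-stable prime[5] (21 + 15 * n) (≤-trans (*-monoˡ-≤ n d≤15) (m≤n+m (15 * n) 21))
  S4n<n : S (4 * n) < n
  S4n<n = *-cancelˡ-< 4 _ _ (legendreSum-< 4 (22 + 15 * n) (4 * n) {{m*n≢0 4 n}})
  shuffle : ∀ n x y z → 1 + (2 * n + x + (y + (z + 0))) ≡ 2 * n + (1 + y) + (z + (x + 0))
  shuffle = solve-∀
  shuffle′ : ∀ n x z → 2 * n + n + (z + (x + 0)) ≡ 3 * n + z + (x + 0)
  shuffle′ = solve-∀

-- From factorial quotients to divisibility

∏!-∣-lift : ∀ a as bs → ∏! (suc a ∷ as) ∣ ∏! (a ∷ bs) → suc a * ∏! as ∣ ∏! bs
∏!-∣-lift a as bs d = *-cancelˡ-∣ (a !) {{a !≢0}}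
  (subst (_∣ a ! * ∏! bs) (shuffle (suc a) (a !) (∏! as)) d)
  where
  shuffle : ∀ s f y → s * f * y ≡ f * (s * y)
  shuffle = solve-∀

-- Cancelling b! turns (b + 1)!/b! into the factor b + 1; with b = 20 this produces the 21.
∏!-∣-lower : ∀ b x as bs → x * ∏! (b ∷ as) ∣ ∏! (suc b ∷ bs) → x * ∏! as ∣ suc b * ∏! bs
∏!-∣-lower b x as bs d = *-cancelˡ-∣ (b !) {{b !≢0}}
  (subst₂ _∣_ (shuffle x (b !) (∏! as)) (shuffle′ (suc b) (b !) (∏! bs)) d)
  where
  shuffle : ∀ s f y → s * (f * y) ≡ f * (s * y)
  shuffle = solve-∀
  shuffle′ : ∀ s f y → s * f * y ≡ f * (s * y)
  shuffle′ = solve-∀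

5*denominator∣numerator : ∀ n .{{_ : NonZero n}} → 5 * ∏! (denominator n) ∣ ∏! (numerator n)
5*denominator∣numerator n = ∏!-∣-lift 4 (denominator n) (numerator n) (∏!-∣ (22 + 15 * n)
  (≤-trans (m≤m+n 5 17) (m≤m+n 22 (15 * n)) ∷ denominator-≤ n)
  (≤-trans (m≤m+n 4 18) (m≤m+n 22 (15 * n)) ∷ numerator-≤ n)
  le)
  where
  le : ∀ p .{{_ : NonZero p}} → Prime p →
    sum (map (legendreSum p (22 + 15 * n)) (5 ∷ denominator n)) ≤
    sum (map (legendreSum p (22 + 15 * n)) (4 ∷ numerator n))
  le p pp with p ≟ 5
  ... | yes refl = legendreSum-5 n
  -- For p ≠ 5 the floors of 5/p and 4/p agree, so the extra factor 5!/4! changes no exponent.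
  ... | no p≢5 = +-mono-≤ (≤-reflexive (cong (λ x → x + legendreSum p (21 + 15 * n) x) (/-suc-∤ p∤5)))
    (sum-legendreSum-mono (22 + 15 * n) 1<p (denominator n) (numerator n) (floors-denominator n))
    where
    1<p : 1 < p
    1<p = nonTrivial⇒n>1 p {{prime⇒nonTrivial pp}}
    p∤5 : p ∤ 5
    p∤5 p∣5 with prime⇒irreducible prime[5] p∣5
    ... | inj₁ refl = ¬prime[1] pp
    ... | inj₂ p≡5  = p≢5 p≡5

[10n+3]*denominator∣21*numerator : ∀ n → (3 + 10 * n) * ∏! (denominator n) ∣ 21 * ∏! (numerator n)
[10n+3]*denominator∣21*numerator n =
  ∏!-∣-lower 20 (3 + 10 * n) (denominator n) (numerator n)
    (∏!-∣-lift (2 + 10 * n) (20 ∷ denominator n) (21 ∷ numerator n)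
      (∏!-∣ (22 + 15 * n)
        (linear-≤ 3 10 n (m≤m+n 3 19) (m≤m+n 10 5) ∷ ≤-trans (m≤m+n 20 2) (m≤m+n 22 (15 * n)) ∷ denominator-≤ n)
        (linear-≤ 2 10 n (m≤m+n 2 20) (m≤m+n 10 5) ∷ ≤-trans (m≤m+n 21 1) (m≤m+n 22 (15 * n)) ∷ numerator-≤ n)
        λ p pp → sum-legendreSum-mono (22 + 15 * n) (nonTrivial⇒n>1 p {{prime⇒nonTrivial pp}})
          (3 + 10 * n ∷ 20 ∷ denominator n) (2 + 10 * n ∷ 21 ∷ numerator n) (floors-denominator-10n+3 n)))

5∤10n+3 : ∀ n → 5 ∤ 3 + 10 * n
5∤10n+3 n d = from-no (5 ∣? 3) (common-factor n 3 (divides 2 refl) ∣-refl d)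

-- Here `z` is t_n. Cancelling the factorials gives 10n + 3 ∣ 5 · 21z, and 10n + 3 is prime to 5.
10n+3∣21*quotient : ∀ n z → ∏! (numerator n) ≡ z * (5 * ∏! (denominator n)) → 3 + 10 * n ∣ 21 * z
10n+3∣21*quotient n z eq = coprime-divisor coprime (subst (3 + 10 * n ∣_) (shuffle z)
  (*-cancelʳ-∣ (∏! (denominator n)) {{∏!≢0 (denominator n)}}
    (subst ((3 + 10 * n) * ∏! (denominator n) ∣_) (trans (cong (21 *_) eq) (shuffle′ z (∏! (denominator n))))
      ([10n+3]*denominator∣21*numerator n))))
  where
  coprime : Coprime (3 + 10 * n) 5
  coprime (d∣10n+3 , d∣5) with prime⇒irreducible prime[5] d∣5
  ... | inj₁ d≡1  = d≡1
  ... | inj₂ refl = contradiction d∣10n+3 (5∤10n+3 n)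
  shuffle : ∀ z → 21 * z * 5 ≡ 5 * (21 * z)
  shuffle = solve-∀
  shuffle′ : ∀ z y → 21 * (z * (5 * y)) ≡ 21 * z * 5 * y
  shuffle′ = solve-∀

-- Binomial coefficients in terms of factorials

C-*-! : ∀ j k {n} → j + k ≡ n → (n C j) * (j ! * k !) ≡ n !
C-*-! j k {n} refl = begin
  (n C j) * (j ! * k !)                   ≡⟨ cong (λ i → (n C j) * (j ! * i !)) (m+n∸m≡n j k) ⟨
  (n C j) * (j ! * (n ∸ j) !)             ≡⟨ cong (_* (j ! * (n ∸ j) !)) (nCk≡n!/k![n-k]! (m≤m+n j k)) ⟩
  n ! / (j ! * (n ∸ j) !) * (j ! * (n ∸ j) !) ≡⟨ m/n*n≡m (k![n∸k]!∣n! (m≤m+n j k)) ⟩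
  n !                                     ∎
  where
  open ≡-Reasoning
  instance _ = j !* (n ∸ j) !≢0

tNumerator≡ : ∀ n .{{_ : NonZero n}} z → ∏! (numerator n) ≡ z * (5 * ∏! (denominator n)) →
  tNumerator n ≡ z * tDenominator n
tNumerator≡ n@(suc m) z eq = cancel
  (15 * n C 5 * n) ((5 * n ∸ 1) C m) (3 * n C n) z (m !) n ((2 * n) !) ((4 * n) !) ((10 * n) !) (10 * n + 1)
  (C-*-! (5 * n) (10 * n) (sym (*-distribʳ-+ n 5 10)))
  -- As n is `suc m`, the term 5n - 1 computes to m + 4n.
  (C-*-! m (4 * n) refl)
  (C-*-! n (2 * n) refl)
  refl
  (cong (_* (10 * n) !) (+-comm (10 * n) 1))
  eq
  {{factor≢0}}
  where
  factor≢0 : NonZero (5 * n * m ! * (2 * n) ! * (4 * n) ! * (10 * n) !)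
  factor≢0 = m*n≢0 _ ((10 * n) !) {{m*n≢0 _ ((4 * n) !) {{m*n≢0 _ ((2 * n) !)
    {{m*n≢0 (5 * n) (m !) {{_}} {{m !≢0}}}} {{(2 * n) !≢0}}}} {{(4 * n) !≢0}}}} {{(10 * n) !≢0}}
  -- The subscripts stand for (2n)!, (3n)! and so on, with `f` for (n - 1)!, `f₅′` for (5n - 1)! and
  -- `s` for 10n + 1. Matching on the equations eliminates the larger factorials and leaves a ring
  -- identity.
  cancel : ∀ A B G z f n f₂ f₄ f₁₀ s {f₃ f₅ f₅′ f₁₁ f₁₅} →
    A * (f₅ * f₁₀) ≡ f₁₅ → B * (f * f₄) ≡ f₅′ → G * (n * f * f₂) ≡ f₃ →
    5 * n * f₅′ ≡ f₅ → s * f₁₀ ≡ f₁₁ →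
    f₁₅ * (f₂ * 1) ≡ z * (5 * (f₁₁ * (f₄ * (f₃ * 1)))) →
    .{{_ : NonZero (5 * n * f * f₂ * f₄ * f₁₀)}} → A * B ≡ z * (s * G)
  cancel A B G z f n f₂ f₄ f₁₀ s refl refl refl refl refl eq = *-cancelʳ-≡ (A * B) (z * (s * G))
    (5 * n * f * f₂ * f₄ * f₁₀) (trans (lhs A B n f f₂ f₄ f₁₀) (trans eq (rhs G z n f f₂ f₄ f₁₀ s)))
    where
    lhs : ∀ A B n f f₂ f₄ f₁₀ → A * B * (5 * n * f * f₂ * f₄ * f₁₀) ≡ A * (5 * n * (B * (f * f₄)) * f₁₀) * (f₂ * 1)
    lhs = solve-∀
    rhs : ∀ G z n f f₂ f₄ f₁₀ s → z * (5 * (s * f₁₀ * (f₄ * (G * (n * f * f₂) * 1)))) ≡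
                                    z * (s * G) * (5 * n * f * f₂ * f₄ * f₁₀)
    rhs = solve-∀

-- Transfer to the rational t_n and the integer congruence

open import Data.Integer.Base as ℤ using (+_)

/≡/1 : ∀ {a} d z .{{_ : NonZero d}} → a ≡ z * d → (+ a) ℚ./ d ≡ (+ z) ℚ./ 1
/≡/1 {a} (suc d) z eq = fromℚᵘ-cong {mkℚᵘ (+ a) d} {mkℚᵘ (+ z) 0} (*≡* (begin
  + a ℤ.* + 1          ≡⟨ ℤ.*-identityʳ (+ a) ⟩
  + a                  ≡⟨ cong +_ eq ⟩
  + (z * suc d)        ≡⟨ ℤ.pos-* z (suc d) ⟩
  + z ℤ.* + suc d      ∎))
  where open ≡-Reasoning

∣⇒≡0 : ∀ n z → 3 + 10 * n ∣ 21 * z → + 21 ℤ.* + z ≡ + 0 [mod + 10 ℤ.* + n ℤ.+ + 3 ]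
∣⇒≡0 n z d = subst₂ _∣ℤ_ lhs rhs (∣ᵤ⇒∣ d)
  where
  open ≡-Reasoning
  lhs : + (3 + 10 * n) ≡ + 10 ℤ.* + n ℤ.+ + 3
  lhs = begin
    + (3 + 10 * n)             ≡⟨ cong +_ (+-comm 3 (10 * n)) ⟩
    + (10 * n + 3)             ≡⟨ ℤ.pos-+ (10 * n) 3 ⟩
    + (10 * n) ℤ.+ + 3         ≡⟨ cong (ℤ._+ + 3) (ℤ.pos-* 10 n) ⟩
    + 10 ℤ.* + n ℤ.+ + 3       ∎
  rhs : + (21 * z) ≡ + 21 ℤ.* + z ℤ.- + 0
  rhs = trans (ℤ.pos-* 21 z) (sym (ℤ.+-identityʳ _))

t≡ : ∀ n .{{_ : NonZero n}} z → ∏! (numerator n) ≡ z * (5 * ∏! (denominator n)) → t n ≡ (+ z) ℚ./ 1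
t≡ n z eq = /≡/1 {tNumerator n} (tDenominator n) z {{tDenominator≢0 n}} (tNumerator≡ n z eq)

theorem1p2-of-∣ : ∀ n .{{_ : NonZero n}} → 5 * ∏! (denominator n) ∣ ∏! (numerator n) →
    ∃[ z ] (t n ≡ z ℚ./ 1) × (+ 21 ℤ.* z ≡ + 0 [mod + 10 ℤ.* + n ℤ.+ + 3 ])
theorem1p2-of-∣ n (divides z eq) = + z , t≡ n z eq , ∣⇒≡0 n z (10n+3∣21*quotient n z eq)

theorem1p2 : (n : ℕ) → .{{_ : NonZero n}} →
    ∃[ z ] (t n ≡ z ℚ./ 1) × (+ 21 ℤ.* z ≡ + 0 [mod + 10 ℤ.* + n ℤ.+ + 3 ])
theorem1p2 n = theorem1p2-of-∣ n (5*denominator∣numerator n)
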